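{- Let $M$ be a nonsingular real symmetric $n \times n$ matrix and let $\alpha \subseteq \{1,\dots,n\}$ with $|\alpha| \geq 2$ such that every subset $\gamma \subseteq \alpha$ with $|\gamma|=2$ is a P-set of $M$. Then $\alpha$ is a P-set of $M$.
   Context: All matrices are real. For an $n\times n$ matrix $A$ and $\alpha \subseteq \{1,\dots,n\}$, $A(\alpha)$ denotes the principal submatrix obtained by deleting the rows and columns indexed by $\alpha$, and $\nu(A)$ denotes the nullity of $A$. A set $\alpha$ is a P-set of $A$ if $\nu(A(\alpha)) = \nu(A) + |\alpha|$. -}

module Defs where

open import Level using (Level; _⊔_) renaming (suc to lsuc)
open import Algebra.Apartness.Bundles using (HeytingField; HeytingCommutativeRing)
open import Algebra.Bundles using (CommutativeRing)
open import Data.Bool.Base using (if_then_else_)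
open import Data.Fin.Base using (Fin; zero; suc)
open import Data.Fin.Properties using (_≟_)
open import Data.Fin.Subset using (Subset; inside; outside; ∁; ∣_∣)
open import Data.Nat.Base as ℕ using (ℕ)
open import Data.Product.Base using (∃-syntax; _×_)
open import Data.Sum.Base using (_⊎_)
open import Data.Vec.Base using (_∷_)
open import Data.Vec.Functional using (Vector)
open import Relation.Binary.Core using (Rel)
open import Relation.Binary.Structures using (IsStrictPartialOrder)
open import Relation.Nullary.Decidable using (does)

-- In a Heyting field the apartness _#_ plays the role of ≠; here it is
-- required to be the one given by the order, so classically the order is
-- total.

record OrderedField c ℓ₁ ℓ₂ ℓ₃ : Set (lsuc (c ⊔ ℓ₁ ⊔ ℓ₂ ⊔ ℓ₃)) where
  infix 4 _<_
  field
    heytingField : HeytingField c ℓ₁ ℓ₂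

  open HeytingField heytingField public
    using (Carrier; _≈_; _#_; _+_; _*_; -_; _-_; 0#; 1#; heytingCommutativeRing)

  field
    _<_                  : Rel Carrier ℓ₃
    isStrictPartialOrder : IsStrictPartialOrder _≈_ _<_
    #⇒<⊎>                : ∀ {x y} → x # y → x < y ⊎ y < x
    <⇒#                  : ∀ {x y} → x < y → x # y
    +-monoˡ-<            : ∀ {x y} z → x < y → x + z < y + z
    *-pos                : ∀ {x y} → 0# < x → 0# < y → 0# < x * y

  commutativeRing : CommutativeRing c ℓ₁
  commutativeRing = HeytingCommutativeRing.commutativeRing heytingCommutativeRing

  open CommutativeRing commutativeRing public using (semiring)
  open import Algebra.Properties.Semiring.Mult semiring public
    using () renaming (_×_ to _·_)

  -- |x - y| < ε
  Within : Carrier → Carrier → Carrier → Set ℓ₃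
  Within ε x y = (x - y < ε) × (y - x < ε)

  IsCauchy : (ℕ → Carrier) → Set (c ⊔ ℓ₃)
  IsCauchy s = ∀ ε → 0# < ε →
    ∃[ N ] (∀ m n → N ℕ.≤ m → N ℕ.≤ n → Within ε (s m) (s n))

  ConvergesTo : (ℕ → Carrier) → Carrier → Set (c ⊔ ℓ₃)
  ConvergesTo s x = ∀ ε → 0# < ε →
    ∃[ N ] (∀ n → N ℕ.≤ n → Within ε (s n) x)

-- The field ℝ, presented axiomatically as a Cauchy-complete Archimedean
-- ordered field: classically these axioms determine it up to isomorphism.
-- No decidability is assumed, so constructive reals are also a model.

record RealField c ℓ₁ ℓ₂ ℓ₃ : Set (lsuc (c ⊔ ℓ₁ ⊔ ℓ₂ ⊔ ℓ₃)) where
  field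
    orderedField : OrderedField c ℓ₁ ℓ₂ ℓ₃

  open OrderedField orderedField public

  field
    archimedean : ∀ x → ∃[ n ] x < n · 1#
    complete    : ∀ s → IsCauchy s → ∃[ x ] ConvergesTo s x

-- The increasing enumeration of the elements of a subset.

nth : ∀ {n} (p : Subset n) → Fin ∣ p ∣ → Fin n
nth (inside  ∷ p) zero    = zero
nth (inside  ∷ p) (suc i) = suc (nth p i)
nth (outside ∷ p) i       = suc (nth p i)

module RealMatrix {c ℓ₁ ℓ₂ ℓ₃ : Level} (R : RealField c ℓ₁ ℓ₂ ℓ₃) where
  open RealField R
  open import Algebra.Properties.Semiring.Sum semiring public using (sum)

  Matrix : ℕ → ℕ → Set c
  Matrix m n = Fin m → Fin n → Carrier

  infix 4 _≈ᴹ_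
  _≈ᴹ_ : ∀ {m n} → Rel (Matrix m n) ℓ₁
  A ≈ᴹ B = ∀ i j → A i j ≈ B i j

  1ᴹ : ∀ {n} → Matrix n n
  1ᴹ i j = if does (i ≟ j) then 1# else 0#

  infixl 7 _*ᴹ_ _*ⱽ_
  _*ᴹ_ : ∀ {l m n} → Matrix l m → Matrix m n → Matrix l n
  (A *ᴹ B) i j = sum λ k → A i k * B k j

  _*ⱽ_ : ∀ {m n} → Matrix m n → Vector Carrier n → Vector Carrier m
  (A *ⱽ v) i = sum λ j → A i j * v j

  Symmetric : ∀ {n} → Matrix n n → Set ℓ₁
  Symmetric A = ∀ i j → A i j ≈ A j i

  Nonsingular : ∀ {n} → Matrix n n → Set (c ⊔ ℓ₁)
  Nonsingular A = ∃[ B ] (A *ᴹ B ≈ᴹ 1ᴹ) × (B *ᴹ A ≈ᴹ 1ᴹ)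

  lincomb : ∀ {k n} → Vector Carrier k → (Fin k → Vector Carrier n) → Vector Carrier n
  lincomb a b i = sum λ t → a t * b t i

  InKernel : ∀ {m n} → Matrix m n → Vector Carrier n → Set ℓ₁
  InKernel A v = ∀ i → (A *ⱽ v) i ≈ 0#

  record IsKernelBasis {m n k} (A : Matrix m n) (b : Fin k → Vector Carrier n)
         : Set (c ⊔ ℓ₁) where
    field
      inKernel    : ∀ t → InKernel A (b t)
      independent : ∀ a → (∀ i → lincomb a b i ≈ 0#) → ∀ t → a t ≈ 0#
      spanning    : ∀ v → InKernel A v → ∃[ a ] (∀ i → v i ≈ lincomb a b i)

  -- ν(A) = k.  Nullity is a relation because computing a basis of the kernel
  -- would require deciding equality in ℝ; k is determined by A since all
  -- bases of the kernel have the same size.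
  HasNullity : ∀ {m n} → Matrix m n → ℕ → Set (c ⊔ ℓ₁)
  HasNullity {n = n} A k = ∃[ b ] IsKernelBasis {k = k} A b

  -- A(α): the rows and columns in α are deleted, so those in ∁ α are kept.
  delete : ∀ {n} → Matrix n n → (α : Subset n) → Matrix ∣ ∁ α ∣ ∣ ∁ α ∣
  delete A α i j = A (nth (∁ α) i) (nth (∁ α) j)

  IsPSet : ∀ {n} → Matrix n n → Subset n → Set (c ⊔ ℓ₁)
  IsPSet A α = ∃[ k ] HasNullity A k × HasNullity (delete A α) (k ℕ.+ ∣ α ∣)

{-# OPTIONS --safe #-}

-- Let B = M⁻¹.  A vector v in the kernel of M(γ), extended by zero to v̂, is sent
-- by M to a vector y supported on γ, and v̂ = B y.  Since v̂ vanishes on γ, y lies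
-- in the kernel of the block B[γ]; as v ↦ y is injective, ν(M(γ)) = 2 = |γ|
-- forces B[γ] = 0.  Running over the pairs γ ⊆ α gives B[α] = 0, and then the
-- columns of B indexed by α, restricted to the complement of α, are a basis of
-- the kernel of M(α).

module Submission where

open import Defs
open import Algebra.Apartness.Bundles using (HeytingField)
open import Algebra.Bundles using (CommutativeRing)
open import Data.Fin.Base using (Fin; zero; suc)
open import Data.Fin.Patterns using (0F; 1F)
open import Data.Fin.Properties using (_≟_; suc-injective)
open import Data.Nat.Base as ℕ using (ℕ; zero; suc; _≤_; s≤s)
open import Data.Fin.Subset
  using (Subset; inside; outside; _⊆_; _∈_; _∪_; ∁; ⁅_⁆; ∣_∣)
open import Data.Fin.Subset.Properties
  using (∪-identityˡ; ∪-identityʳ; ∣⁅x⁆∣≡1; x∈p∪q⁻; x∈p∪q⁺; x∈⁅x⁆; x∈⁅y⁆⇒x≡y)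
open import Data.Product.Base using (∃-syntax; _×_; _,_; proj₁; proj₂)
open import Data.Sum.Base using (inj₁; inj₂)
open import Data.Vec.Base using ([]; _∷_; here; there)
open import Data.Vec.Functional using (Vector)
open import Function.Base using (_∘_)
open import Level using (Level)
open import Relation.Binary.PropositionalEquality as ≡
  using (_≡_; _≢_; cong; subst)
open import Relation.Nullary.Decidable using (yes; no)
open import Relation.Nullary.Negation using (¬_; contradiction)

-- Splitting indices into a subset and its complement.

-- The family `P` is dependent so that one eliminator serves twice: constant `P` glues two vectors,
-- and a predicate `P` gives a proof by cases on membership in `p`.
merge : ∀ {a n} {P : Fin n → Set a} (p : Subset n) →
        (∀ k → P (nth p k)) → (∀ k → P (nth (∁ p) k)) → ∀ i → P i
merge (inside  ∷ p) u v zero    = u zero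
merge (inside  ∷ p) u v (suc i) = merge p (u ∘ suc) v i
merge (outside ∷ p) u v zero    = v zero
merge (outside ∷ p) u v (suc i) = merge p u (v ∘ suc) i

merge-nth : ∀ {a n} {A : Set a} (p : Subset n) {u : Fin ∣ p ∣ → A} {v} k →
            merge p u v (nth p k) ≡ u k
merge-nth (inside  ∷ p) zero    = ≡.refl
merge-nth (inside  ∷ p) (suc k) = merge-nth p k
merge-nth (outside ∷ p) k       = merge-nth p k

merge-nth-∁ : ∀ {a n} {A : Set a} (p : Subset n) {u : Fin ∣ p ∣ → A} {v} k →
              merge p u v (nth (∁ p) k) ≡ v k
merge-nth-∁ (inside  ∷ p) k       = merge-nth-∁ p k
merge-nth-∁ (outside ∷ p) zero    = ≡.refl
merge-nth-∁ (outside ∷ p) (suc k) = merge-nth-∁ p k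

nth-injective : ∀ {n} (p : Subset n) {k l} → nth p k ≡ nth p l → k ≡ l
nth-injective (inside  ∷ p) {zero}  {zero}  eq = ≡.refl
nth-injective (inside  ∷ p) {suc k} {suc l} eq =
  cong suc (nth-injective p (suc-injective eq))
nth-injective (outside ∷ p) eq = nth-injective p (suc-injective eq)

nth-∁≢nth : ∀ {n} (p : Subset n) {k l} → nth (∁ p) k ≢ nth p l
nth-∁≢nth (inside  ∷ p) {k}     {suc l} eq = nth-∁≢nth p (suc-injective eq)
nth-∁≢nth (outside ∷ p) {suc k} {l}     eq = nth-∁≢nth p (suc-injective eq)

nth∈ : ∀ {n} (p : Subset n) k → nth p k ∈ p
nth∈ (inside  ∷ p) zero    = here
nth∈ (inside  ∷ p) (suc k) = there (nth∈ p k)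
nth∈ (outside ∷ p) k       = there (nth∈ p k)

∈⇒nth : ∀ {n} {p : Subset n} {x} → x ∈ p → ∃[ k ] nth p k ≡ x
∈⇒nth here = zero , ≡.refl
∈⇒nth {p = inside  ∷ p} (there x∈p) with ∈⇒nth x∈p
... | k , eq = suc k , cong suc eq
∈⇒nth {p = outside ∷ p} (there x∈p) with ∈⇒nth x∈p
... | k , eq = k , cong suc eq

-- Reduction from a subset to its pairs.

∣⁅x⁆∪⁅y⁆∣≡2 : ∀ {n} {x y : Fin n} → x ≢ y → ∣ ⁅ x ⁆ ∪ ⁅ y ⁆ ∣ ≡ 2
∣⁅x⁆∪⁅y⁆∣≡2 {x = zero}  {zero}  x≢y = contradiction ≡.refl x≢y
∣⁅x⁆∪⁅y⁆∣≡2 {x = zero}  {suc y} x≢y =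
  cong suc (≡.trans (cong ∣_∣ (∪-identityˡ ⁅ y ⁆)) (∣⁅x⁆∣≡1 y))
∣⁅x⁆∪⁅y⁆∣≡2 {x = suc x} {zero}  x≢y =
  cong suc (≡.trans (cong ∣_∣ (∪-identityʳ ⁅ x ⁆)) (∣⁅x⁆∣≡1 x))
∣⁅x⁆∪⁅y⁆∣≡2 {x = suc x} {suc y} x≢y = ∣⁅x⁆∪⁅y⁆∣≡2 (x≢y ∘ cong suc)

∃≢ : ∀ {n} → 2 ≤ n → (i : Fin n) → ∃[ j ] i ≢ j
∃≢ (s≤s (s≤s _)) zero    = 1F , λ ()
∃≢ (s≤s (s≤s _)) (suc i) = 0F , λ ()

-- The hypothesis is applied to γ = {x, y}. Letting `z` and `w` range over the whole pair also
-- covers the diagonal positions (x, x) and (y, y).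
pairs⇒off-diagonal : ∀ {n ℓ} {Q : Fin n → Fin n → Set ℓ} (α : Subset n) →
  (∀ γ → γ ⊆ α → ∣ γ ∣ ≡ 2 → ∀ r s → Q (nth γ r) (nth γ s)) →
  ∀ {x y} → x ∈ α → y ∈ α → x ≢ y →
  ∀ {z w} → z ∈ ⁅ x ⁆ ∪ ⁅ y ⁆ → w ∈ ⁅ x ⁆ ∪ ⁅ y ⁆ → Q z w
pairs⇒off-diagonal α h {x} {y} x∈α y∈α x≢y z∈ w∈ with ∈⇒nth z∈ | ∈⇒nth w∈
... | k , ≡.refl | l , ≡.refl = h _ pair⊆α (∣⁅x⁆∪⁅y⁆∣≡2 x≢y) k l
  where
  pair⊆α : ⁅ x ⁆ ∪ ⁅ y ⁆ ⊆ α
  pair⊆α z∈ with x∈p∪q⁻ ⁅ x ⁆ ⁅ y ⁆ z∈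
  ... | inj₁ z∈x = subst (_∈ α) (≡.sym (x∈⁅y⁆⇒x≡y _ z∈x)) x∈α
  ... | inj₂ z∈y = subst (_∈ α) (≡.sym (x∈⁅y⁆⇒x≡y _ z∈y)) y∈α

pairs⇒all : ∀ {n ℓ} {Q : Fin n → Fin n → Set ℓ} (α : Subset n) → 2 ≤ ∣ α ∣ →
  (∀ γ → γ ⊆ α → ∣ γ ∣ ≡ 2 → ∀ r s → Q (nth γ r) (nth γ s)) →
  ∀ r s → Q (nth α r) (nth α s)
pairs⇒all {Q = Q} α 2≤∣α∣ h r s with r ≟ s
... | no r≢s =
  pairs⇒off-diagonal {Q = Q} α h (nth∈ α r) (nth∈ α s) (r≢s ∘ nth-injective α)
    (x∈p∪q⁺ (inj₁ (x∈⁅x⁆ _))) (x∈p∪q⁺ (inj₂ (x∈⁅x⁆ _)))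
-- A diagonal position needs a partner `t` to form a pair; it exists because α has at least two
-- elements.
... | yes ≡.refl with ∃≢ 2≤∣α∣ r
...   | t , r≢t =
  pairs⇒off-diagonal {Q = Q} α h (nth∈ α r) (nth∈ α t) (r≢t ∘ nth-injective α)
    (x∈p∪q⁺ (inj₁ (x∈⁅x⁆ _))) (x∈p∪q⁺ (inj₁ (x∈⁅x⁆ _)))

module _ {c ℓ₁ ℓ₂ ℓ₃ : Level} (R : RealField c ℓ₁ ℓ₂ ℓ₃) where
  open RealMatrix R
  open RealField R using (commutativeRing; heytingField; heytingCommutativeRing)
  open HeytingField heytingField using (_#_; #⇒invertible; tight)
  open CommutativeRing commutativeRing hiding (_-_; zero)
    renaming (refl to ≈-refl; sym to ≈-sym; trans to ≈-trans; reflexive to ≈-reflexive)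
  open import Algebra.Apartness.Properties.HeytingCommutativeRing heytingCommutativeRing
    using (1#0; x-0≈x)
  open import Algebra.Properties.Ring ring using (-‿distribˡ-*; -‿involutive; -0#≈0#)
  open import Algebra.Properties.Semiring.Sum semiring
    using (sum-cong-≋; *-distribˡ-sum; *-distribʳ-sum; ∑-comm)
  open import Relation.Binary.Reasoning.Setoid setoid

  open import Algebra.Solver.Ring.NaturalCoefficients.Default commutativeSemiring
    using (solve; _:=_; _:+_; _:*_)

  -- Arithmetic in a Heyting field.

  1≉0 : ¬ (1# ≈ 0#)
  1≉0 1≈0 = proj₂ (tight 1# 0#) 1≈0 1#0

  -x≈0⇒x≈0 : ∀ {x} → - x ≈ 0# → x ≈ 0#
  -x≈0⇒x≈0 {x} -x≈0 = begin
    x       ≈⟨ -‿involutive x ⟨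
    - (- x) ≈⟨ -‿cong -x≈0 ⟩
    - 0#    ≈⟨ -0#≈0# ⟩
    0#      ∎

  x≈0⇒xy≈0 : ∀ {x y} → x ≈ 0# → x * y ≈ 0#
  x≈0⇒xy≈0 x≈0 = ≈-trans (*-congʳ x≈0) (zeroˡ _)

  y≈0⇒xy≈0 : ∀ {x y} → y ≈ 0# → x * y ≈ 0#
  y≈0⇒xy≈0 y≈0 = ≈-trans (*-congˡ y≈0) (zeroʳ _)

  x≈0∧y≈0⇒x+y≈0 : ∀ {x y} → x ≈ 0# → y ≈ 0# → x + y ≈ 0#
  x≈0∧y≈0⇒x+y≈0 x≈0 y≈0 = ≈-trans (+-cong x≈0 y≈0) (+-identityˡ _)

  y≈0∧x+y≈0⇒x≈0 : ∀ {x y} → y ≈ 0# → x + y ≈ 0# → x ≈ 0#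
  y≈0∧x+y≈0⇒x≈0 y≈0 x+y≈0 =
    ≈-trans (≈-sym (+-identityʳ _)) (≈-trans (+-congˡ (≈-sym y≈0)) x+y≈0)

  #0-cancel : ∀ {a x} → a # 0# → a * x ≈ 0# → x ≈ 0#
  #0-cancel {a} {x} a#0 ax≈0 with #⇒invertible a#0
  ... | a⁻¹ , a⁻¹a≈1 , _ = begin
    x                     ≈⟨ *-identityˡ x ⟨
    -- Apartness of `a` from `0#` provides an inverse of the difference `a + - 0#`, which is then
    -- simplified to `a`.
    1# * x                ≈⟨ *-congʳ a⁻¹a≈1 ⟨
    a⁻¹ * (a + - 0#) * x  ≈⟨ *-congʳ (*-congˡ (x-0≈x a)) ⟩
    a⁻¹ * a * x           ≈⟨ *-assoc a⁻¹ a x ⟩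
    a⁻¹ * (a * x)         ≈⟨ y≈0⇒xy≈0 ax≈0 ⟩
    0#                    ∎

  -- Finite sums.

  sum-zero : ∀ {n} {f : Vector Carrier n} → (∀ i → f i ≈ 0#) → sum f ≈ 0#
  sum-zero {zero}  f≈0 = ≈-refl
  sum-zero {suc n} f≈0 = x≈0∧y≈0⇒x+y≈0 (f≈0 zero) (sum-zero (f≈0 ∘ suc))

  sum-nth : ∀ {n} (p : Subset n) (f : Vector Carrier n) →
            sum f ≈ sum (f ∘ nth p) + sum (f ∘ nth (∁ p))
  sum-nth []            f = ≈-sym (+-identityˡ 0#)
  sum-nth (inside  ∷ p) f =
    ≈-trans (+-congˡ (sum-nth p (f ∘ suc))) (≈-sym (+-assoc _ _ _))
  sum-nth (outside ∷ p) f = begin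
    f zero + sum (f ∘ suc)                ≈⟨ +-congˡ (sum-nth p (f ∘ suc)) ⟩
    f zero + (u + v)                      ≈⟨ +-assoc _ _ _ ⟨
    f zero + u + v                        ≈⟨ +-congʳ (+-comm _ _) ⟩
    u + f zero + v                        ≈⟨ +-assoc _ _ _ ⟩
    u + (f zero + v)                      ∎
    where
    u = sum (f ∘ suc ∘ nth p)
    v = sum (f ∘ suc ∘ nth (∁ p))

  sum-nthˡ : ∀ {n} (p : Subset n) (f : Vector Carrier n) →
             (∀ k → f (nth (∁ p) k) ≈ 0#) → sum f ≈ sum (f ∘ nth p)
  sum-nthˡ p f f≈0 =
    ≈-trans (sum-nth p f) (≈-trans (+-congˡ (sum-zero f≈0)) (+-identityʳ _))

  sum-nthʳ : ∀ {n} (p : Subset n) (f : Vector Carrier n) →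
             (∀ k → f (nth p k) ≈ 0#) → sum f ≈ sum (f ∘ nth (∁ p))
  sum-nthʳ p f f≈0 =
    ≈-trans (sum-nth p f) (≈-trans (+-congʳ (sum-zero f≈0)) (+-identityˡ _))

  -- Distribute and exchange the two summations. With a bare row `x` it applies both to a row of a
  -- matrix and to the coefficients of a linear combination.
  sum-assoc : ∀ {m n} (x : Vector Carrier m) (A : Matrix m n) (y : Vector Carrier n) →
              sum (λ i → x i * sum (λ j → A i j * y j)) ≈
              sum (λ j → sum (λ i → x i * A i j) * y j)
  sum-assoc {m} {n} x A y = begin
    sum (λ i → x i * sum (λ j → A i j * y j))
      ≈⟨ sum-cong-≋ (λ i → *-distribˡ-sum (x i) (λ j → A i j * y j)) ⟩
    sum (λ i → sum (λ j → x i * (A i j * y j)))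
      ≈⟨ ∑-comm (λ i j → x i * (A i j * y j)) ⟩
    sum (λ j → sum (λ i → x i * (A i j * y j)))
      ≈⟨ sum-cong-≋ (λ j → sum-cong-≋ {m} (λ i → ≈-sym (*-assoc (x i) (A i j) (y j)))) ⟩
    sum (λ j → sum (λ i → x i * A i j * y j))
      ≈⟨ sum-cong-≋ (λ j → *-distribʳ-sum (y j) (λ i → x i * A i j)) ⟨
    sum (λ j → sum (λ i → x i * A i j) * y j) ∎

  -- Invertible matrices and their kernels.

  1ᴹ-identityˡ : ∀ {n} (v : Vector Carrier n) i → (1ᴹ *ⱽ v) i ≈ v i
  1ᴹ-identityˡ v zero    = begin
    1# * v zero + sum (λ j → 0# * v (suc j)) ≈⟨ +-cong (*-identityˡ _) (sum-zero (λ j → zeroˡ (v (suc j)))) ⟩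
    v zero + 0#                              ≈⟨ +-identityʳ _ ⟩
    v zero                                   ∎
  -- The entry of `1ᴹ` at (suc i, suc j) computes to the entry at (i, j), so the tail of the sum is
  -- the inductive case.
  1ᴹ-identityˡ v (suc i) = begin
    0# * v zero + (1ᴹ *ⱽ (v ∘ suc)) i ≈⟨ +-cong (zeroˡ _) (1ᴹ-identityˡ (v ∘ suc) i) ⟩
    0# + v (suc i)                    ≈⟨ +-identityˡ _ ⟩
    v (suc i)                         ∎

  1ᴹ-off-diagonal : ∀ {n} {i j : Fin n} → i ≢ j → 1ᴹ i j ≈ 0#
  1ᴹ-off-diagonal {i = i} {j} i≢j with i ≟ j
  ... | yes i≡j = contradiction i≡j i≢j
  ... | no  _   = ≈-refl

  inverse-*ⱽ : ∀ {n} {A B : Matrix n n} → B *ᴹ A ≈ᴹ 1ᴹ →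
               ∀ v i → v i ≈ (B *ⱽ (A *ⱽ v)) i
  inverse-*ⱽ {A = A} {B} BA≈1 v i = begin
    v i                      ≈⟨ 1ᴹ-identityˡ v i ⟨
    (1ᴹ *ⱽ v) i              ≈⟨ sum-cong-≋ (λ j → *-congʳ (BA≈1 i j)) ⟨
    ((B *ᴹ A) *ⱽ v) i        ≈⟨ sum-assoc (B i) A v ⟨
    (B *ⱽ (A *ⱽ v)) i        ∎

  invertible⇒kernel-trivial : ∀ {n} {A B : Matrix n n} → B *ᴹ A ≈ᴹ 1ᴹ →
                              ∀ v → InKernel A v → ∀ i → v i ≈ 0#
  invertible⇒kernel-trivial {A = A} {B} BA≈1 v v∈ker i =
    ≈-trans (inverse-*ⱽ {A = A} {B} BA≈1 v i) (sum-zero (λ j → y≈0⇒xy≈0 (v∈ker j)))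

  invertible⇒nullity-zero : ∀ {n} {A B : Matrix n n} → B *ᴹ A ≈ᴹ 1ᴹ → HasNullity A 0
  invertible⇒nullity-zero {A = A} {B} BA≈1 = (λ ()) , record
    { inKernel    = λ ()
    ; independent = λ _ _ ()
    ; spanning    = λ v v∈ker → (λ ()) , invertible⇒kernel-trivial {A = A} {B} BA≈1 v v∈ker
    }

  -- All kernel vectors vanish, so a nonempty basis would satisfy the relation with every
  -- coefficient `1#`, against independence.
  invertible⇒nullity≡0 : ∀ {n k} {A B : Matrix n n} → B *ᴹ A ≈ᴹ 1ᴹ → HasNullity A k → k ≡ 0
  invertible⇒nullity≡0 {k = zero}              BA≈1 _              = ≡.refl
  invertible⇒nullity≡0 {k = suc k} {A} {B} BA≈1 (b , isBasis) =
    contradiction (independent (λ _ → 1#) (λ i → sum-zero (λ t → y≈0⇒xy≈0 {x = 1#} (b≈0 t i))) zero) 1≉0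
    where
    open IsKernelBasis isBasis
    b≈0 : ∀ t i → b t i ≈ 0#
    b≈0 t = invertible⇒kernel-trivial {A = A} {B} BA≈1 (b t) (inKernel t)

  -- Independent rows of a two-by-two matrix.

  -- The determinant p s - q r is killed by a, hence 0; then (s, - q) is a linear
  -- dependence of the rows (p, q), (r, s), so q = s = 0 and p = r = 0 follows.
  nonzero-kernel⇒¬rows-independent : ∀ {p q r s a b : Carrier} → a # 0# →
    p * a + q * b ≈ 0# → r * a + s * b ≈ 0# →
    ¬ (∀ x y → x * p + y * r ≈ 0# → x * q + y * s ≈ 0# → x ≈ 0# × y ≈ 0#)
  nonzero-kernel⇒¬rows-independent {p} {q} {r} {s} {a} {b} a#0 eq₀ eq₁ indep =
    1≉0 (proj₁ (indep 1# 1# (x≈0∧y≈0⇒x+y≈0 (y≈0⇒xy≈0 p≈0) (y≈0⇒xy≈0 r≈0))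
                            (x≈0∧y≈0⇒x+y≈0 (y≈0⇒xy≈0 q≈0) (y≈0⇒xy≈0 s≈0))))
    where
    sq-qs≈0 : s * q + - q * s ≈ 0#
    sq-qs≈0 = begin
      s * q + - q * s   ≈⟨ +-cong (*-comm s q) (≈-sym (-‿distribˡ-* q s)) ⟩
      q * s + - (q * s) ≈⟨ -‿inverseʳ (q * s) ⟩
      0#                ∎

    -- With `- q` generalised to `t` the identity contains no negation and holds in every
    -- commutative semiring.
    rearrange : ∀ t → a * (s * p + t * r) + b * (s * q + t * s) ≈
                      s * (p * a + q * b) + t * (r * a + s * b)
    rearrange t = solve 7
      (λ p q r s a b t → (a :* (s :* p :+ t :* r) :+ b :* (s :* q :+ t :* s)) :=
                         (s :* (p :* a :+ q :* b) :+ t :* (r :* a :+ s :* b)))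
      ≈-refl p q r s a b t

    sp-qr≈0 : s * p + - q * r ≈ 0#
    sp-qr≈0 = #0-cancel a#0 (y≈0∧x+y≈0⇒x≈0 (y≈0⇒xy≈0 sq-qs≈0)
      (≈-trans (rearrange (- q)) (x≈0∧y≈0⇒x+y≈0 (y≈0⇒xy≈0 eq₀) (y≈0⇒xy≈0 eq₁))))

    s≈0 : s ≈ 0#
    s≈0 = proj₁ (indep s (- q) sp-qr≈0 sq-qs≈0)

    q≈0 : q ≈ 0#
    q≈0 = -x≈0⇒x≈0 (proj₂ (indep s (- q) sp-qr≈0 sq-qs≈0))

    p≈0 : p ≈ 0#
    p≈0 = #0-cancel a#0 (≈-trans (*-comm a p) (y≈0∧x+y≈0⇒x≈0 (x≈0⇒xy≈0 q≈0) eq₀))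

    r≈0 : r ≈ 0#
    r≈0 = #0-cancel a#0 (≈-trans (*-comm a r) (y≈0∧x+y≈0⇒x≈0 (x≈0⇒xy≈0 s≈0) eq₁))

  -- Equality is not decidable, so each coordinate of `c` is handled by tightness: were it apart
  -- from `0#`, the rows of `y` could not be independent.
  independent₂⇒annihilator≈0 : (y : Matrix 2 2) →
    (∀ a → (∀ s → lincomb a y s ≈ 0#) → ∀ t → a t ≈ 0#) →
    ∀ c → (∀ t → (y *ⱽ c) t ≈ 0#) → ∀ s → c s ≈ 0#
  independent₂⇒annihilator≈0 y indep c yc≈0 = λ where
      0F → proj₁ (tight _ _) λ c₀#0 →
        nonzero-kernel⇒¬rows-independent c₀#0 (eq 0F) (eq 1F) indep′
      -- The same argument with the two columns of `y` interchanged.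
      1F → proj₁ (tight _ _) λ c₁#0 →
        nonzero-kernel⇒¬rows-independent c₁#0 (eq′ 0F) (eq′ 1F)
          λ x z e₁ e₀ → indep′ x z e₀ e₁
    where
    flat : ∀ x z → x + (z + 0#) ≈ x + z
    flat x z = +-congˡ (+-identityʳ z)
    eq : ∀ t → y t 0F * c 0F + y t 1F * c 1F ≈ 0#
    eq t = ≈-trans (≈-sym (flat _ _)) (yc≈0 t)
    eq′ : ∀ t → y t 1F * c 1F + y t 0F * c 0F ≈ 0#
    eq′ t = ≈-trans (+-comm _ _) (eq t)
    indep′ : ∀ x z → x * y 0F 0F + z * y 1F 0F ≈ 0# → x * y 0F 1F + z * y 1F 1F ≈ 0# →
             x ≈ 0# × z ≈ 0#
    indep′ x z e₀ e₁ = a≈0 0F , a≈0 1F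
      where
      a : Vector Carrier 2
      a 0F = x
      a 1F = z
      a≈0 : ∀ t → a t ≈ 0#
      a≈0 = indep a λ where
        0F → ≈-trans (flat _ _) e₀
        1F → ≈-trans (flat _ _) e₁

  -- Kernels of principal submatrices and blocks of the inverse.

  module _ {n} {A B : Matrix n n} (AB≈1 : A *ᴹ B ≈ᴹ 1ᴹ) (BA≈1 : B *ᴹ A ≈ᴹ 1ᴹ)
           (p : Subset n) where

    extend : Vector Carrier ∣ ∁ p ∣ → Vector Carrier n
    extend v = merge p (λ _ → 0#) v

    image : Vector Carrier ∣ ∁ p ∣ → Vector Carrier ∣ p ∣
    image v = (A *ⱽ extend v) ∘ nth p

    -- Apply `B` to `w`, the product of `A` with the extension. Outside `p` the entries of `w` are
    -- those of `delete A p *ⱽ v`, hence zero, so only the columns of `B` in `p` contribute.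
    extend-expand : ∀ v → InKernel (delete A p) v →
      ∀ i → extend v i ≈ sum (λ s → image v s * B i (nth p s))
    extend-expand v v∈ker i = begin
      extend v i                                 ≈⟨ inverse-*ⱽ {A = A} {B} BA≈1 (extend v) i ⟩
      sum (λ j → B i j * w j)                    ≈⟨ sum-nthˡ p (λ j → B i j * w j) (λ k → y≈0⇒xy≈0 (w≈0 k)) ⟩
      sum (λ s → B i (nth p s) * image v s)      ≈⟨ sum-cong-≋ (λ s → *-comm (B i (nth p s)) (image v s)) ⟩
      sum (λ s → image v s * B i (nth p s))      ∎
      where
      w = A *ⱽ extend v
      w≈0 : ∀ k → w (nth (∁ p) k) ≈ 0#
      w≈0 k = begin
        w (nth (∁ p) k)
          ≈⟨ sum-nthʳ p (λ j → A (nth (∁ p) k) j * extend v j)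
               (λ s → y≈0⇒xy≈0 (≈-reflexive (merge-nth p s))) ⟩
        sum (λ l → A (nth (∁ p) k) (nth (∁ p) l) * extend v (nth (∁ p) l))
          ≈⟨ sum-cong-≋ (λ l → *-congˡ (≈-reflexive (merge-nth-∁ p l))) ⟩
        (delete A p *ⱽ v) k
          ≈⟨ v∈ker k ⟩
        0# ∎

    -- The rows of `extend-expand` outside `p`. Recovering `v` from `image v` gives injectivity in
    -- one direction of the proof and spanning in the other.
    kernel-expand : ∀ v → InKernel (delete A p) v →
      ∀ k → v k ≈ sum (λ s → image v s * B (nth (∁ p) k) (nth p s))
    kernel-expand v v∈ker k =
      ≈-trans (≈-sym (≈-reflexive (merge-nth-∁ p k))) (extend-expand v v∈ker (nth (∁ p) k))

    -- The rows of `extend-expand` inside `p`, where the extension is zero by construction.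
    image-annihilated : ∀ v → InKernel (delete A p) v →
      ∀ r → sum (λ s → image v s * B (nth p r) (nth p s)) ≈ 0#
    image-annihilated v v∈ker r =
      ≈-trans (≈-sym (extend-expand v v∈ker (nth p r))) (≈-reflexive (merge-nth p r))

    -- By `kernel-expand` a fixed linear map takes each image back to its basis vector, so a
    -- relation among the images is one among the basis vectors.
    image-independent : ∀ {k} {b : Fin k → Vector Carrier ∣ ∁ p ∣} →
      IsKernelBasis (delete A p) b →
      ∀ a → (∀ s → lincomb a (image ∘ b) s ≈ 0#) → ∀ t → a t ≈ 0#
    image-independent {b = b} isBasis a a·y≈0 = independent a λ k → begin
      sum (λ t → a t * b t k)
        ≈⟨ sum-cong-≋ (λ t → *-congˡ (kernel-expand (b t) (inKernel t) k)) ⟩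
      sum (λ t → a t * sum (λ s → image (b t) s * B (nth (∁ p) k) (nth p s)))
        ≈⟨ sum-assoc a (image ∘ b) (λ s → B (nth (∁ p) k) (nth p s)) ⟩
      sum (λ s → lincomb a (image ∘ b) s * B (nth (∁ p) k) (nth p s))
        ≈⟨ sum-zero (λ s → x≈0⇒xy≈0 (a·y≈0 s)) ⟩
      0# ∎
      where open IsKernelBasis isBasis

    -- One row of the block at a time: row `r` is annihilated by the images of both basis vectors,
    -- which are independent in a space of dimension two.
    nullity₂⇒inverse-block≈0 : ∣ p ∣ ≡ 2 → HasNullity (delete A p) 2 →
                               ∀ r s → B (nth p r) (nth p s) ≈ 0#
    nullity₂⇒inverse-block≈0 ∣p∣≡2 (b , isBasis) r =
      annihilator≈0 ∣p∣≡2 (image ∘ b) (image-independent isBasis)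
        (λ s → B (nth p r) (nth p s))
        (λ t → image-annihilated (b t) (inKernel t) r)
      where
      open IsKernelBasis isBasis
      -- The size `∣ p ∣` becomes a variable `m` so that the equation with 2 can be matched.
      annihilator≈0 : ∀ {m} → m ≡ 2 → (y : Matrix 2 m) →
        (∀ a → (∀ s → lincomb a y s ≈ 0#) → ∀ t → a t ≈ 0#) →
        ∀ c → (∀ t → (y *ⱽ c) t ≈ 0#) → ∀ s → c s ≈ 0#
      annihilator≈0 ≡.refl = independent₂⇒annihilator≈0

    inverse-block≈0⇒nullity : (∀ r s → B (nth p r) (nth p s) ≈ 0#) →
                              HasNullity (delete A p) ∣ p ∣
    inverse-block≈0⇒nullity B[p]≈0 = column , record
      { inKernel    = column∈ker
      ; independent = column-independent
      ; spanning    = λ v v∈ker → image v , kernel-expand v v∈ker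
      }
      where
      column : Fin ∣ p ∣ → Vector Carrier ∣ ∁ p ∣
      column s k = B (nth (∁ p) k) (nth p s)

      -- Entries of the full column of `B` inside `p` vanish, so the product with the restricted
      -- column is an off-diagonal entry of `A *ᴹ B`.
      column∈ker : ∀ s → InKernel (delete A p) (column s)
      column∈ker s k = begin
        (delete A p *ⱽ column s) k
          ≈⟨ sum-nthʳ p (λ j → A (nth (∁ p) k) j * B j (nth p s)) (λ r → y≈0⇒xy≈0 (B[p]≈0 r s)) ⟨
        (A *ᴹ B) (nth (∁ p) k) (nth p s)
          ≈⟨ AB≈1 _ _ ⟩
        1ᴹ (nth (∁ p) k) (nth p s)
          ≈⟨ 1ᴹ-off-diagonal (nth-∁≢nth p) ⟩
        0# ∎

      column-independent : ∀ a → (∀ k → lincomb a column k ≈ 0#) → ∀ s → a s ≈ 0#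
      column-independent a a·b≈0 s =
        ≈-trans (≈-sym (≈-reflexive (merge-nth p s)))
                (invertible⇒kernel-trivial {A = B} {A} AB≈1 â B*â≈0 (nth p s))
        where
        â : Vector Carrier n
        â = merge p a (λ _ → 0#)

        expand : ∀ i → (B *ⱽ â) i ≈ sum (λ r → a r * B i (nth p r))
        expand i = begin
          sum (λ j → B i j * â j)
            ≈⟨ sum-nthˡ p (λ j → B i j * â j) (λ k → y≈0⇒xy≈0 (≈-reflexive (merge-nth-∁ p k))) ⟩
          sum (λ r → B i (nth p r) * â (nth p r))
            ≈⟨ sum-cong-≋ (λ r → ≈-trans (*-congˡ (≈-reflexive (merge-nth p r))) (*-comm _ (a r))) ⟩
          sum (λ r → a r * B i (nth p r)) ∎

        B*â≈0 : InKernel B â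
        -- Inside `p` the product vanishes by the zero block, outside by the assumed relation;
        -- invertibility of `B` then kills `â`.
        B*â≈0 = merge p
          (λ r → ≈-trans (expand _) (sum-zero (λ t → y≈0⇒xy≈0 (B[p]≈0 r t))))
          (λ k → ≈-trans (expand _) (a·b≈0 k))

theorem2p4 : ∀ {c ℓ₁ ℓ₂ ℓ₃} (R : RealField c ℓ₁ ℓ₂ ℓ₃) →
    let open RealMatrix R in
    (n : ℕ) (M : Matrix n n) → Nonsingular M → Symmetric M →
    (α : Subset n) → 2 ≤ ∣ α ∣ →
    (∀ γ → γ ⊆ α → ∣ γ ∣ ≡ 2 → IsPSet M γ) →
    IsPSet M α
theorem2p4 R n M (B , MB≈1 , BM≈1) _ α 2≤∣α∣ pairs =
  -- Since ν(M) = 0, the nullity required of M(α) computes to `∣ α ∣`.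
  0 , invertible⇒nullity-zero R {A = M} {B} BM≈1 ,
  inverse-block≈0⇒nullity R MB≈1 BM≈1 α
    (pairs⇒all {Q = λ i j → B i j ≈ 0#} α 2≤∣α∣ λ γ γ⊆α ∣γ∣≡2 →
      nullity₂⇒inverse-block≈0 R MB≈1 BM≈1 γ ∣γ∣≡2 (nullity₂ γ ∣γ∣≡2 (pairs γ γ⊆α ∣γ∣≡2)))
  where
  open RealMatrix R
  open CommutativeRing (RealField.commutativeRing R) using (_≈_; 0#)

  -- Each P-set hypothesis carries its own value `k` for ν(M), which must first be identified with
  -- 0.
  nullity₂ : ∀ γ → ∣ γ ∣ ≡ 2 → IsPSet M γ → HasNullity (delete M γ) 2
  nullity₂ γ ∣γ∣≡2 (k , ν[M]≡k , ν[M[γ]]≡k+∣γ∣) =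
    subst (HasNullity (delete M γ))
      (≡.cong₂ ℕ._+_ (invertible⇒nullity≡0 R {A = M} {B} BM≈1 ν[M]≡k) ∣γ∣≡2)
      ν[M[γ]]≡k+∣γ∣
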